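{- Let $\iota$ be a unimodal sp-implication, let $(\mathfrak F_i)_{i\in I}$ be a family of frames and $\mathfrak G$ a frame with $(\mathfrak F_i)_{i\in I}\gg\mathfrak G$. If $\mathfrak F_i$ validates $\iota$ for every $i\in I$, then $\mathfrak G$ validates $\iota$.
   Context: Unimodal setting: one diamond $\Diamond$; sp-formulas built from variables and $\top$ by $\wedge,\Diamond$; sp-implications $\sigma\to\tau$; frames $(W,R)$ with standard Kripke semantics, a frame validating $\sigma\to\tau$ if at every point of every model over it $\sigma$ implies $\tau$. A homomorphism $h:(W_1,R_1)\to(W_2,R_2)$ is a map with $(x,y)\in R_1\Rightarrow(h(x),h(y))\in R_2$. A finite tree is a finite frame $(T,R^{\mathfrak T})$ that is a directed tree (irreflexive, with a root from which every point is reached by a unique path). Let $\mathfrak F_i=(W_i,R_i)$ ($i\in I$), $\mathfrak G=(W,R^{\mathfrak G})$, $\mathfrak T=(T,R^{\mathfrak T})$ be frames, $w\in T$, $g_i:\mathfrak T\to\mathfrak F_i$ and $h:\mathfrak T\to\mathfrak G$ homomorphisms, and $Z\subseteq(\prod_{i\in I}W_i)\times W$. Write $(\mathfrak F_i,g_i)_{i\in I}\gg_Z(\mathfrak G,h,w)$ if: (s1) $((g_i(w))_{i\in I},h(w))\in Z$; (s2) for all $(\bar x,y)\in Z$ and $\bar x'=(x'_i)_{i\in I}\in\prod_iW_i$ with $(x_i,x'_i)\in R_i$ for all $i$, there is $y'$ with $(y,y')\in R^{\mathfrak G}$ and $(\bar x',y')\in Z$; (s3) for all $(\bar x,y)\in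 Z$ and $A\subseteq T$, if $x_i\in g_i[A]$ for all $i\in I$ then $y\in h[A]$. Write $(\mathfrak F_i)_{i\in I}\gg\mathfrak G$ if for every finite tree $\mathfrak T$ with root $w$ and every homomorphism $h:\mathfrak T\to\mathfrak G$ there exist homomorphisms $g_i:\mathfrak T\to\mathfrak F_i$ ($i\in I$) and $Z$ such that $(\mathfrak F_i,g_i)_{i\in I}\gg_Z(\mathfrak G,h,w)$. -}

module Defs where

open import Level using (Level; suc)
open import Data.Nat.Base using (ℕ)
open import Data.Fin.Base using (Fin)
open import Data.List.Base using (List; []; _∷_)
open import Data.Product.Base using (∃-syntax; _×_)
open import Data.Unit.Polymorphic.Base using () renaming (⊤ to Unit)
open import Function.Bundles using (_↔_)
open import Relation.Binary.Core using (Rel; REL)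
open import Relation.Binary.Definitions using (Irreflexive)
open import Relation.Binary.Construct.Closure.ReflexiveTransitive using (Star; ε; _◅_)
open import Relation.Binary.Morphism.Structures using (IsRelHomomorphism)
open import Relation.Binary.PropositionalEquality.Core using (_≡_)
open import Relation.Unary using (Pred; _∈_)

data SPFormula : Set where
  var : ℕ → SPFormula
  ⊤   : SPFormula
  _∧_ : SPFormula → SPFormula → SPFormula
  ◇_  : SPFormula → SPFormula

infixr 6 _∧_
infix  8 ◇_

infix 4 _⇒_

record SPImplication : Set where
  constructor _⇒_
  field
    antecedent consequent : SPFormula

record Frame (ℓ : Level) : Set (suc ℓ) where
  field
    W : Set ℓ
    R : Rel W ℓ

open Frame public

Valuation : ∀ {ℓ} → Frame ℓ → Set (suc ℓ)
Valuation {ℓ} 𝔉 = ℕ → Pred (W 𝔉) ℓ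

infix 4 _,_,_⊨_ _validates_

_,_,_⊨_ : ∀ {ℓ} (𝔉 : Frame ℓ) → Valuation 𝔉 → W 𝔉 → SPFormula → Set ℓ
𝔉 , V , x ⊨ var p   = x ∈ V p
𝔉 , V , x ⊨ ⊤       = Unit
𝔉 , V , x ⊨ (φ ∧ ψ) = (𝔉 , V , x ⊨ φ) × (𝔉 , V , x ⊨ ψ)
𝔉 , V , x ⊨ (◇ φ)   = ∃[ y ] R 𝔉 x y × (𝔉 , V , y ⊨ φ)

_validates_ : ∀ {ℓ} → Frame ℓ → SPImplication → Set (suc ℓ)
𝔉 validates (σ ⇒ τ) = ∀ (V : Valuation 𝔉) (x : W 𝔉) → 𝔉 , V , x ⊨ σ → 𝔉 , V , x ⊨ τ

record Hom {ℓ} (𝔉 𝔊 : Frame ℓ) : Set ℓ where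
  field
    ⟦_⟧               : W 𝔉 → W 𝔊
    isRelHomomorphism : IsRelHomomorphism (R 𝔉) (R 𝔊) ⟦_⟧

open Hom public

points : ∀ {ℓ} (𝔉 : Frame ℓ) {x y : W 𝔉} → Star (R 𝔉) x y → List (W 𝔉)
points 𝔉 {x} ε       = x ∷ []
points 𝔉 {x} (_ ◅ π) = x ∷ points 𝔉 π

-- R is Set-valued and need not be a mere proposition, so paths are compared by
-- the sequence of points they visit, not as elements of Star.
record IsFiniteTree {ℓ} (𝔗 : Frame ℓ) (root : W 𝔗) : Set ℓ where
  field
    finite      : ∃[ n ] (W 𝔗 ↔ Fin n)
    irreflexive : Irreflexive _≡_ (R 𝔗)
    reachable   : ∀ x → Star (R 𝔗) root x
    unique-path : ∀ {x} (π π′ : Star (R 𝔗) root x) → points 𝔗 π ≡ points 𝔗 π′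

infix 10 _[_]

_[_] : ∀ {ℓ} {X Y : Set ℓ} → (X → Y) → Pred X ℓ → Pred Y ℓ
f [ A ] = λ y → ∃[ a ] a ∈ A × f a ≡ y

-- Z ⊆ (∏ᵢ Wᵢ) × W is curried.
record Simulation {ℓ} {I : Set ℓ} (𝔉 : I → Frame ℓ) {𝔗 : Frame ℓ}
                  (g : ∀ i → Hom 𝔗 (𝔉 i)) (𝔊 : Frame ℓ) (h : Hom 𝔗 𝔊) (w : W 𝔗)
                  (Z : REL (∀ i → W (𝔉 i)) (W 𝔊) ℓ) : Set (suc ℓ) where
  field
    s1 : Z (λ i → ⟦ g i ⟧ w) (⟦ h ⟧ w)
    s2 : ∀ {x y} → Z x y →
         ∀ x′ → (∀ i → R (𝔉 i) (x i) (x′ i)) →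
         ∃[ y′ ] R 𝔊 y y′ × Z x′ y′
    s3 : ∀ {x y} → Z x y →
         ∀ (A : Pred (W 𝔗) ℓ) → (∀ i → x i ∈ ⟦ g i ⟧ [ A ]) → y ∈ ⟦ h ⟧ [ A ]

infix 4 _≫_

_≫_ : ∀ {ℓ} {I : Set ℓ} → (I → Frame ℓ) → Frame ℓ → Set (suc ℓ)
_≫_ {ℓ} 𝔉 𝔊 =
  ∀ (𝔗 : Frame ℓ) (w : W 𝔗) → IsFiniteTree 𝔗 w → (h : Hom 𝔗 𝔊) →
  ∃[ g ] ∃[ Z ] Simulation 𝔉 {𝔗} g 𝔊 h w Z

{-# OPTIONS --safe #-}
-- A point satisfying the antecedent σ in a model over 𝔊 is the root image of a
-- homomorphism h from the syntax tree of σ.  Given gᵢ and Z for this h, value p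
-- on 𝔉ᵢ by gᵢ[A p], where A p is the preimage under h of the value of p on 𝔊.
-- The root image under gᵢ satisfies σ, hence the consequent τ, for every i; and
-- (s2), (s3) are what is needed to carry sp-formulas along Z from all the 𝔉ᵢ
-- to 𝔊, so that (s1) yields τ at the original point.
module Submission where

open import Data.Empty.Polymorphic using (⊥)
open import Data.Fin.Base using (Fin; zero; suc)
open import Data.Fin.Properties using (+↔⊎)
open import Data.List.Base as List using (List; []; _∷_; _++_; _∷ʳ_)
open import Data.List.Properties using (map-++; ++-assoc; ++-cancelˡ; ++-identityʳ-unique)
open import Data.Maybe.Base as Maybe using (Maybe; just; nothing; maybe′)
open import Data.Nat.Base as ℕ using ()
open import Data.Product.Base using (∃-syntax; _×_; _,_; proj₁; proj₂)
open import Data.Sum.Base using (_⊎_; inj₁; inj₂)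
open import Data.Sum.Function.Propositional using (_⊎-↔_)
open import Data.Unit.Polymorphic.Base using (tt)
open import Function.Base using (_∘_)
open import Function.Bundles using (_↔_; mk↔ₛ′; module Inverse)
open import Function.Properties.Inverse using (↔-sym; ↔-trans)
open import Level using (Level)
open import Relation.Binary.Construct.Closure.ReflexiveTransitive using (Star; ε; _◅_; gmap)
open import Relation.Binary.Core using (REL)
open import Relation.Binary.Definitions using (Irreflexive)
open import Relation.Binary.Morphism.Structures using (module IsRelHomomorphism)
open import Relation.Binary.PropositionalEquality using (_≡_; refl; sym; trans; cong; subst; module ≡-Reasoning)
open import Relation.Unary using (_∈_)

open import Defs

private
  variable
    ℓ : Level

Maybe-Fin : ∀ {A : Set ℓ} {n} → A ↔ Fin n → Maybe A ↔ Fin (ℕ.suc n)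
Maybe-Fin A↔n = mk↔ₛ′
  (maybe′ (suc ∘ to) zero)
  (λ { zero → nothing ; (suc k) → just (from k) })
  (λ { zero → refl ; (suc k) → cong suc (strictlyInverseˡ k) })
  (λ { nothing → refl ; (just a) → cong just (strictlyInverseʳ a) })
  where open Inverse A↔n

map-≡-∷ʳ : ∀ {A B : Set ℓ} (f : A → B) {xs ys x} →
           xs ≡ ys ∷ʳ x → List.map f xs ≡ List.map f ys ∷ʳ f x
map-≡-∷ʳ f {ys = ys} {x} refl = map-++ f ys (x ∷ [])

module _ (𝔉 : Frame ℓ) (ancestors : W 𝔉 → List (W 𝔉))
         (ancestors-step : ∀ {x y} → R 𝔉 x y → ancestors y ≡ ancestors x ∷ʳ x) where

  -- A loop at `x` would equate `ancestors x` with itself extended by one entry.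
  ancestors-irreflexive : Irreflexive _≡_ (R 𝔉)
  ancestors-irreflexive {x} refl r
    with () ← ++-identityʳ-unique (ancestors x) (ancestors-step r)

  -- Each step moves one point from the path into the ancestor list, so the concatenation stays the
  -- same. Cancelling `ancestors x` then shows that the points visited depend only on the two ends.
  ancestors-points : ∀ {x y} (π : Star (R 𝔉) x y) →
                     ancestors x ++ points 𝔉 π ≡ ancestors y ∷ʳ y
  ancestors-points         ε                 = refl
  ancestors-points {x} {y} (_◅_ {j = z} r π) = begin
    ancestors x ++ x ∷ points 𝔉 π          ≡⟨ ++-assoc (ancestors x) (x ∷ []) _ ⟨
    (ancestors x ∷ʳ x) ++ points 𝔉 π       ≡⟨ cong (_++ points 𝔉 π) (ancestors-step r) ⟨
    ancestors z ++ points 𝔉 π              ≡⟨ ancestors-points π ⟩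
    ancestors y ∷ʳ y                       ∎
    where open ≡-Reasoning

  ancestors-unique-path : ∀ {x y} (π π′ : Star (R 𝔉) x y) → points 𝔉 π ≡ points 𝔉 π′
  ancestors-unique-path {x} π π′ =
    ++-cancelˡ (ancestors x) _ _ (trans (ancestors-points π) (sym (ancestors-points π′)))

-- Truth of sp-formulas is positive and existential, so it survives along any homomorphism that
-- respects the valuations.
⊨-hom : ∀ {𝔉 𝔊 : Frame ℓ} (f : Hom 𝔉 𝔊) {U : Valuation 𝔉} {V : Valuation 𝔊} →
        (∀ p {x} → x ∈ U p → ⟦ f ⟧ x ∈ V p) →
        ∀ φ {x} → 𝔉 , U , x ⊨ φ → 𝔊 , V , ⟦ f ⟧ x ⊨ φ
⊨-hom f U⊆V (var p) s           = U⊆V p s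
⊨-hom f U⊆V ⊤       s           = tt
⊨-hom f U⊆V (φ ∧ ψ) (s , t)     = ⊨-hom f U⊆V φ s , ⊨-hom f U⊆V ψ t
⊨-hom f U⊆V (◇ φ)   (y , r , s) =
  ⟦ f ⟧ y , IsRelHomomorphism.cong (isRelHomomorphism f) r , ⊨-hom f U⊆V φ s

-- The non-root points of the syntax tree of a formula; the root is `nothing` in
-- Maybe (Inner ℓ φ).  A conjunction identifies the roots of its conjuncts.
Inner : ∀ ℓ → SPFormula → Set ℓ
Inner ℓ (var _) = ⊥
Inner ℓ ⊤       = ⊥
Inner ℓ (φ ∧ ψ) = Inner ℓ φ ⊎ Inner ℓ ψ
Inner ℓ (◇ φ)   = Maybe (Inner ℓ φ)

-- Under a diamond, the argument `nothing` is the root of the subtree for `φ`, and its parent is the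
-- new root. In the conjunction cases `Maybe.map` keeps the root shared.
parent : ∀ φ → Inner ℓ φ → Maybe (Inner ℓ φ)
parent (φ ∧ ψ) (inj₁ n) = Maybe.map inj₁ (parent φ n)
parent (φ ∧ ψ) (inj₂ n) = Maybe.map inj₂ (parent ψ n)
parent (◇ φ)   nothing  = nothing
parent (◇ φ)   (just n) = just (parent φ n)

-- There is one edge per non-root point; the two equations let a match on `refl` recover both ends.
tree : ∀ ℓ → SPFormula → Frame ℓ
tree ℓ φ = record
  { W = Maybe (Inner ℓ φ)
  ; R = λ u v → ∃[ n ] parent φ n ≡ u × just n ≡ v
  }

∧-injˡ : ∀ φ ψ → Hom (tree ℓ φ) (tree ℓ (φ ∧ ψ))
∧-injˡ φ ψ = record
  { ⟦_⟧ = Maybe.map inj₁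
  ; isRelHomomorphism = record { cong = λ { (n , refl , refl) → inj₁ n , refl , refl } }
  }

∧-injʳ : ∀ φ ψ → Hom (tree ℓ ψ) (tree ℓ (φ ∧ ψ))
∧-injʳ φ ψ = record
  { ⟦_⟧ = Maybe.map inj₂
  ; isRelHomomorphism = record { cong = λ { (n , refl , refl) → inj₂ n , refl , refl } }
  }

◇-inj : ∀ φ → Hom (tree ℓ φ) (tree ℓ (◇ φ))
◇-inj φ = record
  { ⟦_⟧ = just
  ; isRelHomomorphism = record { cong = λ { (n , refl , refl) → just n , refl , refl } }
  }

Inner-finite : ∀ φ → ∃[ n ] (Inner ℓ φ ↔ Fin n)
Inner-finite (var _) = 0 , mk↔ₛ′ (λ ()) (λ ()) (λ ()) (λ ())
Inner-finite ⊤       = 0 , mk↔ₛ′ (λ ()) (λ ()) (λ ()) (λ ())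
Inner-finite (φ ∧ ψ) =
  _ , ↔-trans (proj₂ (Inner-finite φ) ⊎-↔ proj₂ (Inner-finite ψ)) (↔-sym +↔⊎)
Inner-finite (◇ φ)   = _ , Maybe-Fin (proj₂ (Inner-finite φ))

-- The list runs from the root down to the parent and omits the point itself, so it grows by exactly
-- one entry along each edge.
ancestors : ∀ φ → Maybe (Inner ℓ φ) → List (Maybe (Inner ℓ φ))
ancestors φ       nothing         = []
ancestors (φ ∧ ψ) (just (inj₁ n)) = List.map (Maybe.map inj₁) (ancestors φ (just n))
ancestors (φ ∧ ψ) (just (inj₂ n)) = List.map (Maybe.map inj₂) (ancestors ψ (just n))
ancestors (◇ φ)   (just u)        = nothing ∷ List.map just (ancestors φ u)

-- The root has its own clause in `ancestors`, so the two sides do not compute for an undetermined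
-- `u` such as `parent φ n` until a case split.
ancestors-∧ˡ : ∀ φ ψ (u : Maybe (Inner ℓ φ)) →
               List.map (Maybe.map inj₁) (ancestors φ u) ≡ ancestors (φ ∧ ψ) (Maybe.map inj₁ u)
ancestors-∧ˡ φ ψ nothing  = refl
ancestors-∧ˡ φ ψ (just _) = refl

ancestors-∧ʳ : ∀ φ ψ (u : Maybe (Inner ℓ ψ)) →
               List.map (Maybe.map inj₂) (ancestors ψ u) ≡ ancestors (φ ∧ ψ) (Maybe.map inj₂ u)
ancestors-∧ʳ φ ψ nothing  = refl
ancestors-∧ʳ φ ψ (just _) = refl

ancestors-parent : ∀ φ (n : Inner ℓ φ) →
                   ancestors φ (just n) ≡ ancestors φ (parent φ n) ∷ʳ parent φ n
ancestors-parent (φ ∧ ψ) (inj₁ n) =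
  trans (map-≡-∷ʳ (Maybe.map inj₁) (ancestors-parent φ n))
        (cong (_∷ʳ Maybe.map inj₁ (parent φ n)) (ancestors-∧ˡ φ ψ (parent φ n)))
ancestors-parent (φ ∧ ψ) (inj₂ n) =
  trans (map-≡-∷ʳ (Maybe.map inj₂) (ancestors-parent ψ n))
        (cong (_∷ʳ Maybe.map inj₂ (parent ψ n)) (ancestors-∧ʳ φ ψ (parent ψ n)))
ancestors-parent (◇ φ)   nothing  = refl
ancestors-parent (◇ φ)   (just n) = cong (nothing ∷_) (map-≡-∷ʳ just (ancestors-parent φ n))

Star-hom : ∀ {𝔉 𝔊 : Frame ℓ} (f : Hom 𝔉 𝔊) {x y} →
           Star (R 𝔉) x y → Star (R 𝔊) (⟦ f ⟧ x) (⟦ f ⟧ y)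
Star-hom f = gmap ⟦ f ⟧ (IsRelHomomorphism.cong (isRelHomomorphism f))

tree-reachable : ∀ φ u → Star (R (tree ℓ φ)) nothing u
tree-reachable φ       nothing         = ε
tree-reachable (φ ∧ ψ) (just (inj₁ n)) = Star-hom (∧-injˡ φ ψ) (tree-reachable φ (just n))
tree-reachable (φ ∧ ψ) (just (inj₂ n)) = Star-hom (∧-injʳ φ ψ) (tree-reachable ψ (just n))
tree-reachable (◇ φ)   (just u)        =
  (nothing , refl , refl) ◅ Star-hom (◇-inj φ) (tree-reachable φ u)

tree-isFiniteTree : ∀ φ → IsFiniteTree (tree ℓ φ) nothing
tree-isFiniteTree φ = record
  { finite      = _ , Maybe-Fin (proj₂ (Inner-finite φ))
  ; irreflexive = ancestors-irreflexive (tree _ φ) (ancestors φ) step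
  ; reachable   = tree-reachable φ
  ; unique-path = ancestors-unique-path (tree _ φ) (ancestors φ) step
  }
  where
  step : ∀ {u v} → R (tree _ φ) u v → ancestors φ v ≡ ancestors φ u ∷ʳ u
  step (n , refl , refl) = ancestors-parent φ n

module _ (𝔊 : Frame ℓ) (V : Valuation 𝔊) where

  -- The images of the non-root points are the successors that the satisfaction proof supplies for
  -- the diamonds of `φ`.
  witness : ∀ φ {x} → 𝔊 , V , x ⊨ φ → Maybe (Inner ℓ φ) → W 𝔊
  witness φ       {x} s           nothing         = x
  witness (φ ∧ ψ)     (s , t)     (just (inj₁ n)) = witness φ s (just n)
  witness (φ ∧ ψ)     (s , t)     (just (inj₂ n)) = witness ψ t (just n)
  witness (◇ φ)       (y , r , s) (just u)        = witness φ s u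

  witness-∧ˡ : ∀ φ ψ {x} (s : 𝔊 , V , x ⊨ φ) (t : 𝔊 , V , x ⊨ ψ) u →
               witness φ s u ≡ witness (φ ∧ ψ) (s , t) (Maybe.map inj₁ u)
  witness-∧ˡ φ ψ s t nothing  = refl
  witness-∧ˡ φ ψ s t (just _) = refl

  witness-∧ʳ : ∀ φ ψ {x} (s : 𝔊 , V , x ⊨ φ) (t : 𝔊 , V , x ⊨ ψ) u →
               witness ψ t u ≡ witness (φ ∧ ψ) (s , t) (Maybe.map inj₂ u)
  witness-∧ʳ φ ψ s t nothing  = refl
  witness-∧ʳ φ ψ s t (just _) = refl

  witness-parent : ∀ φ {x} (s : 𝔊 , V , x ⊨ φ) n →
                   R 𝔊 (witness φ s (parent φ n)) (witness φ s (just n))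
  witness-parent (φ ∧ ψ) (s , t) (inj₁ n) =
    subst (λ z → R 𝔊 z _) (witness-∧ˡ φ ψ s t (parent φ n)) (witness-parent φ s n)
  witness-parent (φ ∧ ψ) (s , t) (inj₂ n) =
    subst (λ z → R 𝔊 z _) (witness-∧ʳ φ ψ s t (parent ψ n)) (witness-parent ψ t n)
  -- This edge joins the new root to the root of the subtree, whose images are `x` and `y`.
  witness-parent (◇ φ)   (y , r , s) nothing  = r
  witness-parent (◇ φ)   (y , r , s) (just n) = witness-parent φ s n

  witness-hom : ∀ φ {x} → 𝔊 , V , x ⊨ φ → Hom (tree ℓ φ) 𝔊
  witness-hom φ s = record
    { ⟦_⟧ = witness φ s
    ; isRelHomomorphism = record { cong = λ { (n , refl , refl) → witness-parent φ s n } }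
    }

  -- Each subformula holds at the root of its own syntax tree, and `⊨-hom` carries it along the
  -- inclusion into the larger tree.
  witness-root-⊨ : ∀ φ {x} (s : 𝔊 , V , x ⊨ φ) →
                   tree ℓ φ , (λ p u → witness φ s u ∈ V p) , nothing ⊨ φ
  witness-root-⊨ (var p) s           = s
  witness-root-⊨ ⊤       s           = tt
  witness-root-⊨ (φ ∧ ψ) (s , t)     =
      ⊨-hom (∧-injˡ φ ψ) (λ p {u} → subst (V p) (witness-∧ˡ φ ψ s t u)) φ (witness-root-⊨ φ s)
    , ⊨-hom (∧-injʳ φ ψ) (λ p {u} → subst (V p) (witness-∧ʳ φ ψ s t u)) ψ (witness-root-⊨ ψ t)
  witness-root-⊨ (◇ φ)   (y , r , s) =
    just nothing , (nothing , refl , refl) , ⊨-hom (◇-inj φ) (λ p v → v) φ (witness-root-⊨ φ s)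

module _ {I : Set ℓ} {𝔉 : I → Frame ℓ} {𝔗 : Frame ℓ} {g : ∀ i → Hom 𝔗 (𝔉 i)}
         {𝔊 : Frame ℓ} {h : Hom 𝔗 𝔊} {w : W 𝔗} {Z : REL (∀ i → W (𝔉 i)) (W 𝔊) ℓ}
         (sim : Simulation 𝔉 g 𝔊 h w Z) where

  open Simulation sim

  simulation-⊨ : ∀ (U : Valuation 𝔗) {V : Valuation 𝔊} →
                 (∀ p {u} → u ∈ U p → ⟦ h ⟧ u ∈ V p) →
                 ∀ φ {x y} → Z x y →
                 (∀ i → 𝔉 i , (λ p → ⟦ g i ⟧ [ U p ]) , x i ⊨ φ) → 𝔊 , V , y ⊨ φ
  -- With `U p` as the set `A`, the premise of (s3) is exactly the truth of `p` at every coordinate.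
  simulation-⊨ U U⊆V (var p) z s with s3 z (U p) s
  ... | a , a∈Up , refl = U⊆V p a∈Up
  simulation-⊨ U U⊆V ⊤       z s = tt
  simulation-⊨ U U⊆V (φ ∧ ψ) z s =
    simulation-⊨ U U⊆V φ z (proj₁ ∘ s) , simulation-⊨ U U⊆V ψ z (proj₂ ∘ s)
  -- Since `s` is a function of `i`, its first components already form the tuple of successors that
  -- (s2) asks for.
  simulation-⊨ U U⊆V (◇ φ)   z s with s2 z (proj₁ ∘ s) (proj₁ ∘ proj₂ ∘ s)
  ... | y′ , r , z′ = y′ , r , simulation-⊨ U U⊆V φ z′ (proj₂ ∘ proj₂ ∘ s)

theorem9p1 : ∀ {ℓ} (ι : SPImplication) {I : Set ℓ} (𝔉 : I → Frame ℓ) (𝔊 : Frame ℓ) →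
    𝔉 ≫ 𝔊 → (∀ i → 𝔉 i validates ι) → 𝔊 validates ι
theorem9p1 (σ ⇒ τ) 𝔉 𝔊 𝔉≫𝔊 valid V x x⊨σ
  with 𝔉≫𝔊 (tree _ σ) nothing (tree-isFiniteTree σ) (witness-hom 𝔊 V σ x⊨σ)
... | g , Z , sim =
  simulation-⊨ sim U (λ _ v → v) τ (Simulation.s1 sim) λ i →
    -- The value of `p` on `𝔉 i` is the image of `U p` under `g i`, so `g i` respects the valuations
    -- and carries `σ` from the root of the tree.
    valid i _ _ (⊨-hom (g i) (λ _ {u} v → u , v , refl) σ (witness-root-⊨ 𝔊 V σ x⊨σ))
  where
  U : Valuation (tree _ σ)
  U p u = witness 𝔊 V σ x⊨σ u ∈ V p
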